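{- Let $n\ge 1$ and let $K$ be the complete graph on $n$ vertices. Then every orbit of toric promotion $\mathrm{TPro}:\Omega_K\to\Omega_K$ has length $n$.
   Context: Toric promotion. Let $G=(V,E)$ be a finite simple graph (undirected, no loops, no multiple edges) on $N$ vertices. A labeling of $G$ is a bijection $\sigma:V\to\mathbb{Z}/N\mathbb{Z}=\{1,\dots,N\}$ (addition modulo $N$). A state is a pair $(\sigma,i)$ with $\sigma$ a labeling of $G$ and $i\in\mathbb{Z}/N\mathbb{Z}$; $\Omega_G$ is the set of all states. Toric promotion is the map $\mathrm{TPro}:\Omega_G\to\Omega_G$ given by $\mathrm{TPro}(\sigma,i)=(\sigma,i+1)$ if $\{\sigma^{ -1}(i),\sigma^{ -1}(i+1)\}\in E$, and $\mathrm{TPro}(\sigma,i)=((i,i+1)\circ\sigma,\,i+1)$ otherwise, where $(i,i+1)$ is the permutation of $\mathbb{Z}/N\mathbb{Z}$ swapping $i$ and $i+1$. It is a bijection of $\Omega_G$. The length of the orbit containing $(\sigma,i)$ is the least $L\ge 1$ with $\mathrm{TPro}^L(\sigma,i)=(\sigma,i)$. -}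

module Defs where

open import Data.Fin.Base using (Fin; toℕ)
open import Data.Fin.Permutation using (transpose)
open import Data.Nat.Base using (ℕ; suc; _≤_; NonZero)
open import Data.Nat.DivMod using (_mod_)
open import Data.Nat.GeneralisedArithmetic using (iterate)
open import Data.Product.Base using (_×_; _,_)
open import Function.Bundles using (_↔_; Inverse)
open import Function.Construct.Composition using (_↔-∘_)
open import Relation.Binary.Core using (Rel)
open import Relation.Binary.Definitions using (Decidable; Irreflexive; Symmetric)
open import Relation.Binary.PropositionalEquality.Core using (_≡_; _≢_)
open import Relation.Nullary.Decidable.Core using (yes; no)
open import Level using (0ℓ)

record SimpleGraph (N : ℕ) : Set₁ where
  field
    Vertex      : Set
    enumeration : Vertex ↔ Fin N
    Adj         : Rel Vertex 0ℓ
    adj?        : Decidable Adj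
    adj-sym     : Symmetric Adj
    adj-irrefl  : Irreflexive _≡_ Adj

IsComplete : ∀ {N} → SimpleGraph N → Set
IsComplete G = ∀ u v → u ≢ v → Adj u v
  where open SimpleGraph G

-- ℤ/Nℤ is represented by Fin N, with 0 standing for the residue class of N.
next : ∀ {N} .{{_ : NonZero N}} → Fin N → Fin N
next {N} i = suc (toℕ i) mod N

module _ {N : ℕ} (G : SimpleGraph N) where

  open SimpleGraph G

  Labeling : Set
  Labeling = Vertex ↔ Fin N

  State : Set
  State = Labeling × Fin N

  -- Without function extensionality, labelings are compared pointwise:
  -- the proof components of _↔_ must not count.
  infix 4 _≈ₛ_
  _≈ₛ_ : Rel State 0ℓ
  (σ , i) ≈ₛ (τ , j) = (∀ v → Inverse.to σ v ≡ Inverse.to τ v) × i ≡ j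

  TPro : .{{_ : NonZero N}} → State → State
  TPro (σ , i) with adj? (Inverse.from σ i) (Inverse.from σ (next i))
  ... | yes _ = σ , next i
  ... | no  _ = transpose i (next i) ↔-∘ σ , next i

-- L is the least positive integer with f^L x ≈ x.
OrbitLength : {A : Set} → Rel A 0ℓ → (A → A) → A → ℕ → Set
OrbitLength _≈_ f x L =
  1 ≤ L × iterate f x L ≈ x × (∀ m → 1 ≤ m → iterate f x m ≈ x → L ≤ m)

{-# OPTIONS --safe #-}
-- In a complete graph, TPro never changes the labels: a swap happens only when
-- i and i + 1 have the same preimage, that is for n = 1, where it is trivial.
-- So TPro only increments i, and it has the order n of 1 in ℤ/nℤ.
module Submission where

open import Defs
open import Data.Fin.Base using (Fin; toℕ)
open import Data.Fin.Permutation using (transpose; _⟨$⟩ʳ_)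
open import Data.Fin.Properties using (_≟_; toℕ-fromℕ<; toℕ-injective; toℕ<n)
open import Data.Nat.Base using (ℕ; zero; suc; _+_; _*_; NonZero; >-nonZero; >-nonZero⁻¹)
open import Data.Nat.Divisibility using (_∣_; divides; ∣⇒≤; ∣-refl)
open import Data.Nat.DivMod using (_%_; _/_; m%n<n; m<n⇒m%n≡m; m≡m%n+[m/n]*n; %-distribˡ-+; m%n%n≡m%n; %-remove-+ˡ)
open import Data.Nat.GeneralisedArithmetic using (iterate)
open import Data.Nat.Properties using (+-comm; +-suc; +-cancelʳ-≡)
open import Data.Product.Base using (_,_; proj₁; proj₂)
open import Function.Bundles using (Inverse)
open import Relation.Binary.PropositionalEquality
  using (_≡_; refl; sym; trans; cong; module ≡-Reasoning)
open import Relation.Nullary using (yes; no; contradiction)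

open ≡-Reasoning

-- For `n = 1`, `next i` is `i` and no vertex is adjacent to itself, so `TPro` takes its swap
-- branch; this makes that swap harmless.
transpose-same : ∀ {n} (i k : Fin n) → transpose i i ⟨$⟩ʳ k ≡ k
transpose-same i k with k ≟ i
... | yes k≡i = sym k≡i
-- `transpose` compares `k` with its second argument only once the first test has failed; here that
-- argument is again `i`.
... | no  k≢i with k ≟ i
...   | yes k≡i = sym k≡i
...   | no  _   = refl

[m+n%d]%d≡[m+n]%d : ∀ m n d .{{_ : NonZero d}} → (m + n % d) % d ≡ (m + n) % d
[m+n%d]%d≡[m+n]%d m n d = begin
  (m + n % d) % d          ≡⟨ %-distribˡ-+ m (n % d) d ⟩
  (m % d + n % d % d) % d  ≡⟨ cong (λ r → (m % d + r) % d) (m%n%n≡m%n n d) ⟩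
  (m % d + n % d) % d      ≡⟨ %-distribˡ-+ m n d ⟨
  (m + n) % d              ∎

-- Division with remainder turns the hypothesis into `m + n ≡ n + q * d`, and cancelling `n`
-- exhibits `m` as a multiple of `d`.
[m+n]%d≡n⇒d∣m : ∀ m n d .{{_ : NonZero d}} → (m + n) % d ≡ n → d ∣ m
[m+n]%d≡n⇒d∣m m n d eq = divides q (+-cancelʳ-≡ n m (q * d) (begin
  m + n                ≡⟨ m≡m%n+[m/n]*n (m + n) d ⟩
  (m + n) % d + q * d  ≡⟨ cong (_+ q * d) eq ⟩
  n + q * d            ≡⟨ +-comm n (q * d) ⟩
  q * d + n            ∎))
  where q = (m + n) / d

module _ {n : ℕ} .{{_ : NonZero n}} where

  toℕ-iterate-next : ∀ (i : Fin n) m → toℕ (iterate next i m) ≡ (m + toℕ i) % n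
  toℕ-iterate-next i zero    = sym (m<n⇒m%n≡m (toℕ<n i))
  toℕ-iterate-next i (suc m) = begin
    toℕ (iterate next (next i) m)    ≡⟨ toℕ-iterate-next (next i) m ⟩
    -- `toℕ (next i)` is itself a remainder modulo `n`, which the outer reduction then absorbs.
    (m + toℕ (next i)) % n           ≡⟨ cong (λ k → (m + k) % n) (toℕ-fromℕ< (m%n<n (suc (toℕ i)) n)) ⟩
    (m + suc (toℕ i) % n) % n        ≡⟨ [m+n%d]%d≡[m+n]%d m (suc (toℕ i)) n ⟩
    (m + suc (toℕ i)) % n            ≡⟨ cong (_% n) (+-suc m (toℕ i)) ⟩
    suc (m + toℕ i) % n              ∎

  iterate-next-period : ∀ (i : Fin n) → iterate next i n ≡ i
  iterate-next-period i = toℕ-injective (begin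
    toℕ (iterate next i n)  ≡⟨ toℕ-iterate-next i n ⟩
    (n + toℕ i) % n         ≡⟨ %-remove-+ˡ (toℕ i) ∣-refl ⟩
    toℕ i % n               ≡⟨ m<n⇒m%n≡m (toℕ<n i) ⟩
    toℕ i                   ∎)

  -- This is the source of minimality: a positive multiple of `n` is at least `n`.
  iterate-next-fixed⇒∣ : ∀ (i : Fin n) m → iterate next i m ≡ i → n ∣ m
  iterate-next-fixed⇒∣ i m eq =
    [m+n]%d≡n⇒d∣m m (toℕ i) n (trans (sym (toℕ-iterate-next i m)) (cong toℕ eq))

  module _ (G : SimpleGraph n) where

    open SimpleGraph G

    TPro-index : ∀ s → proj₂ (TPro G s) ≡ next (proj₂ s)
    TPro-index (σ , i) with adj? (Inverse.from σ i) (Inverse.from σ (next i))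
    ... | yes _ = refl
    ... | no  _ = refl

    -- The index moves independently of the labels, in any graph, so the rotation by 1 studied above
    -- governs it.
    iterate-TPro-index : ∀ s m → proj₂ (iterate (TPro G) s m) ≡ iterate next (proj₂ s) m
    iterate-TPro-index s zero    = refl
    iterate-TPro-index s (suc m) =
      trans (iterate-TPro-index (TPro G s) m) (cong (λ i → iterate next i m) (TPro-index s))

    module _ (complete : IsComplete G) where

      TPro-labels : ∀ s v → Inverse.to (proj₁ (TPro G s)) v ≡ Inverse.to (proj₁ s) v
      TPro-labels (σ , i) v with adj? (Inverse.from σ i) (Inverse.from σ (next i))
      ... | yes _  = refl
      ... | no ¬adj with i ≟ next i
      ...   | yes i≡next =
        trans (cong (λ j → transpose i j ⟨$⟩ʳ Inverse.to σ v) (sym i≡next))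
              (transpose-same i (Inverse.to σ v))
      -- The bijection `σ` has distinct preimages at distinct labels, and completeness makes these
      -- adjacent.
      ...   | no  i≢next = contradiction (complete _ _ from≢) ¬adj
        where
        from≢ = λ eq → i≢next (begin
          i                                         ≡⟨ Inverse.strictlyInverseˡ σ i ⟨
          Inverse.to σ (Inverse.from σ i)           ≡⟨ cong (Inverse.to σ) eq ⟩
          Inverse.to σ (Inverse.from σ (next i))    ≡⟨ Inverse.strictlyInverseˡ σ (next i) ⟩
          next i                                    ∎)

      iterate-TPro-labels : ∀ s m v →
        Inverse.to (proj₁ (iterate (TPro G) s m)) v ≡ Inverse.to (proj₁ s) v
      iterate-TPro-labels s zero    v = refl
      iterate-TPro-labels s (suc m) v =
        trans (iterate-TPro-labels (TPro G s) m v) (TPro-labels s v)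

proposition3 : ∀ (n : ℕ) .{{_ : NonZero n}} (K : SimpleGraph n) → IsComplete K →
    (s : State K) → OrbitLength (_≈ₛ_ K) (TPro K) s n
proposition3 n K complete s@(_ , i) =
    >-nonZero⁻¹ n
  , ( iterate-TPro-labels K complete s n
    , trans (iterate-TPro-index K s n) (iterate-next-period i))
  -- The return of the index alone bounds `m`; `1≤m` excludes `m = 0`, which `n` also divides.
  , λ m 1≤m (_ , eq) →
      ∣⇒≤ {{>-nonZero 1≤m}}
        (iterate-next-fixed⇒∣ i m (trans (sym (iterate-TPro-index K s m)) eq))
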